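{- For any positive integers $t$ and $h$, there is a graph with treewidth $t$ and pathwidth at least $t(h+1)-1$ that contains no subdivision of a complete binary tree of height $3\max(h+1,\lceil\log_2 t\rceil)$.
   Context: Graphs are finite, simple and undirected. A complete binary tree of height $c$ is a rooted tree in which every non-leaf node has two children and every root-to-leaf path has $c$ edges; a subdivision of a tree is obtained by replacing each edge $uv$ by a path from $u$ to $v$ whose internal vertices are new and private to that path. "Contains" means as a subgraph. -}

module Defs where

open import Data.Nat using (ℕ; zero; suc; _+_; _*_; _∸_; _^_; _≤_; _<_; s≤s; z≤n)
open import Data.Nat.Properties using (<-irrefl; m≤m+n; ≤-<-trans; m<m+n; ≤-refl)
open import Data.Fin using (Fin; toℕ)
open import Data.Fin.Subset using (Subset; _∈_; ∣_∣)
open import Data.List using (List; []; _∷_; _∷ʳ_; _++_; length)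
open import Data.List.Relation.Unary.Linked using (Linked)
open import Data.List.Relation.Unary.Unique.Propositional using (Unique)
open import Data.List.Membership.Propositional renaming (_∈_ to _∈ₗ_)
open import Data.Product using (Σ; ∃; _×_; _,_)
open import Data.Sum using (_⊎_; inj₁; inj₂)
open import Data.Empty using (⊥)
open import Relation.Nullary using (¬_)
open import Relation.Binary.PropositionalEquality using (_≡_; _≢_; sym; subst)

record Graph (n : ℕ) : Set₁ where
  field
    _~_    : Fin n → Fin n → Set
    ~-sym  : ∀ {u v} → u ~ v → v ~ u
    irrefl : ∀ u → ¬ (u ~ u)
open Graph public

data Walk {n : ℕ} (G : Graph n) (P : Fin n → Set) : Fin n → Fin n → Set where
  here : ∀ {u} → P u → Walk G P u u
  step : ∀ {u w v} → P u → _~_ G u w → Walk G P w v → Walk G P u v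

data Everything {n : ℕ} : Fin n → Set where
  tt : ∀ {v} → Everything v

Connected : ∀ {n} → Graph n → Set
Connected G = ∀ u v → Walk G Everything u v

HasCycle : ∀ {n} → Graph n → Set
HasCycle {n} G = Σ (Fin n) λ a → Σ (List (Fin n)) λ rest →
  (2 ≤ length rest) × Unique (a ∷ rest) × Linked (_~_ G) (a ∷ (rest ∷ʳ a))

IsTree : ∀ {n} → Graph n → Set
IsTree G = Connected G × ¬ HasCycle G

record Decomposition {n m : ℕ} (G : Graph n) (T : Graph m) : Set where
  field
    bag       : Fin m → Subset n
    cover     : ∀ v → ∃ λ x → v ∈ bag x
    edgeCover : ∀ u v → _~_ G u v → ∃ λ x → (u ∈ bag x) × (v ∈ bag x)
    connected : ∀ v x y → v ∈ bag x → v ∈ bag y → Walk T (λ z → v ∈ bag z) x y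
open Decomposition public

WidthAtMost : ∀ {n m} {G : Graph n} {T : Graph m} → Decomposition G T → ℕ → Set
WidthAtMost {m = m} D k = ∀ (x : Fin m) → ∣ bag D x ∣ ∸ 1 ≤ k

WidthAtLeast : ∀ {n m} {G : Graph n} {T : Graph m} → Decomposition G T → ℕ → Set
WidthAtLeast {m = m} D k = ∃ λ (x : Fin m) → k ≤ ∣ bag D x ∣ ∸ 1

record TreeDecomposition {n : ℕ} (G : Graph n) : Set₁ where
  field
    m      : ℕ
    T      : Graph (suc m)
    isTree : IsTree T
    dec    : Decomposition G T

private
  n≢1+n : ∀ n → ¬ (n ≡ suc n)
  n≢1+n n e = <-irrefl e (s≤s (≤-refl))
  n≢2n+1 : ∀ n → ¬ (n ≡ 2 * n + 1)
  n≢2n+1 n e = <-irrefl e (≤-<-trans (m≤m+n n (n + 0)) (m<m+n _ (s≤s z≤n)))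
  n≢2n+2 : ∀ n → ¬ (n ≡ 2 * n + 2)
  n≢2n+2 n e = <-irrefl e (≤-<-trans (m≤m+n n (n + 0)) (m<m+n _ (s≤s z≤n)))

PathGraph : (k : ℕ) → Graph k
PathGraph k = record
  { _~_ = λ i j → (toℕ j ≡ suc (toℕ i)) ⊎ (toℕ i ≡ suc (toℕ j))
  ; ~-sym = λ { (inj₁ e) → inj₂ e ; (inj₂ e) → inj₁ e }
  ; irrefl = λ u → λ { (inj₁ e) → n≢1+n _ e ; (inj₂ e) → n≢1+n _ e } }

record PathDecomposition {n : ℕ} (G : Graph n) : Set where
  field
    m   : ℕ
    dec : Decomposition G (PathGraph (suc m))

HasTreewidth : ∀ {n} → Graph n → ℕ → Set₁
HasTreewidth G t =
  (Σ (TreeDecomposition G) λ D → WidthAtMost (TreeDecomposition.dec D) t)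
  × (∀ (D : TreeDecomposition G) → WidthAtLeast (TreeDecomposition.dec D) t)

PathwidthAtLeast : ∀ {n} → Graph n → ℕ → Set
PathwidthAtLeast G k = ∀ (D : PathDecomposition G) → WidthAtLeast (PathDecomposition.dec D) k

-- Complete binary tree of height c, heap-indexed on 0 … 2^(c+1) − 2:
-- node i has children 2i+1 and 2i+2.

ChildOf : ℕ → ℕ → Set
ChildOf i j = (j ≡ 2 * i + 1) ⊎ (j ≡ 2 * i + 2)

CompleteBinaryTree : (c : ℕ) → Graph (2 ^ suc c ∸ 1)
CompleteBinaryTree c = record
  { _~_ = λ i j → ChildOf (toℕ i) (toℕ j) ⊎ ChildOf (toℕ j) (toℕ i)
  ; ~-sym = λ { (inj₁ e) → inj₂ e ; (inj₂ e) → inj₁ e }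
  ; irrefl = λ u → λ { (inj₁ (inj₁ e)) → n≢2n+1 _ e ; (inj₁ (inj₂ e)) → n≢2n+2 _ e
                     ; (inj₂ (inj₁ e)) → n≢2n+1 _ e ; (inj₂ (inj₂ e)) → n≢2n+2 _ e } }

-- G contains (as a subgraph) a subdivision of H: branch vertices φ(u),
-- and for each edge uv of H (taken once, with u < v) a φ(u)–φ(v) path in G
-- whose internal vertices are new (not branch vertices) and private.

record ContainsSubdivision {n k : ℕ} (G : Graph n) (H : Graph k) : Set where
  field
    φ         : Fin k → Fin n
    φ-inj     : ∀ a b → φ a ≡ φ b → a ≡ b
    internal  : ∀ u v → _~_ H u v → toℕ u < toℕ v → List (Fin n)
    isPath    : ∀ u v (e : _~_ H u v) (lt : toℕ u < toℕ v) →
                Linked (_~_ G) (φ u ∷ (internal u v e lt ∷ʳ φ v))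
                × Unique (φ u ∷ (internal u v e lt ∷ʳ φ v))
    new       : ∀ u v (e : _~_ H u v) (lt : toℕ u < toℕ v) →
                ∀ w → w ∈ₗ internal u v e lt → ∀ a → φ a ≢ w
    private'  : ∀ u v u' v' (e : _~_ H u v) (lt : toℕ u < toℕ v)
                  (e' : _~_ H u' v') (lt' : toℕ u' < toℕ v') →
                (u ≢ u' ⊎ v ≢ v') →
                ∀ w → w ∈ₗ internal u v e lt → ¬ (w ∈ₗ internal u' v' e' lt')

{-# OPTIONS --safe #-}

-- Blow up each node of the complete ternary tree of height h to a chain of t vertices,
-- chaining blocks so that the vertices themselves form a tree (last vertex of the parent
-- block above the first vertex of the child block), and join any two vertices lying in a
-- common bag {v and its t nearest ancestors}.  These bags give treewidth at most t, and a
-- full bag is a clique of size t + 1, which the Helly property puts into one bag of any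
-- tree decomposition.  Vertices with the same index form a copy of the ternary tree, so
-- the usual induction for the pathwidth of ternary trees runs for all t indices at once:
-- some bag contains h + 1 vertices of each index.  The graph has at most 4^h t vertices,
-- too few for the forbidden tree, whatever the edges are.
module Submission where

open import Defs
open import Data.Nat using (ℕ; suc; _+_; _*_; _∸_; _≤_; _⊔_)
open import Data.Nat.Logarithm using (⌈log₂_⌉)
open import Data.Product using (Σ; _×_)
open import Relation.Nullary using (¬_)

open import Data.Nat using (zero; _^_; _<_; z≤n; s≤s; ⌈_/2⌉; ⌊_/2⌋)
open import Data.Nat.Induction using (<-wellFounded)
open import Data.Nat.Logarithm.Core using (⌈log2⌉)
import Data.Nat.Properties as ℕ
open import Data.Fin using (Fin; zero; suc; toℕ; fromℕ; inject₁; pred; combine; remQuot; _≟_)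
open import Data.Fin.Properties
  using (toℕ-injective; toℕ-inject₁; toℕ-fromℕ; toℕ≤pred[n]; suc-injective; injective⇒≤;
         remQuot-combine; combine-remQuot)
open import Data.Fin.Subset using (Subset; inside; outside; _∈_; ∣_∣; ⁅_⁆; _∪_; _-_; ⋃)
open import Data.Fin.Subset.Properties
  using (_∈?_; x∈⁅x⁆; x∈⁅y⁆⇒x≡y; ∣⁅x⁆∣≡1; ∣⊥∣≡0; ∉⊥; x∈p∪q⁺; x∈p∪q⁻;
         x∈p∧x≢y⇒x∈p-y; x∈p⇒∣p-x∣<∣p∣)
open import Data.List using (List; []; _∷_; _∷ʳ_; length; map; iterate)
open import Data.List.Properties using (length-iterate)
open import Data.List.Membership.Propositional renaming (_∈_ to _∈ₗ_)
open import Data.List.Relation.Unary.All as All using (All; []; _∷_)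
open import Data.List.Relation.Unary.AllPairs using ([]; _∷_)
open import Data.List.Relation.Unary.Any using (here; there)
open import Data.List.Relation.Unary.Linked using (Linked; []; [-]; _∷_)
open import Data.List.Relation.Unary.Unique.Propositional using (Unique)
open import Data.Product using (∃; _,_; proj₁; proj₂; uncurry)
open import Data.Sum using (_⊎_; inj₁; inj₂; swap)
open import Data.Unit using (⊤)
open import Data.Vec using ([]; _∷_)
open import Function using (_∘_; id)
open import Function.Definitions using (Injective)
open import Induction.WellFounded using (Acc; acc)
open import Relation.Nullary using (yes; no; contradiction)
open import Relation.Binary.PropositionalEquality
  using (_≡_; _≢_; refl; sym; trans; cong; cong₂; subst)

-- Walks and paths

walk-start : ∀ {n} {G : Graph n} {P u v} → Walk G P u v → P u
walk-start (here p)     = p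
walk-start (step p _ _) = p

walk-map : ∀ {n} {G : Graph n} {P Q : Fin n → Set} {u v} →
           (∀ {z} → P z → Q z) → Walk G P u v → Walk G Q u v
walk-map f (here p)     = here (f p)
walk-map f (step p e s) = step (f p) e (walk-map f s)

infixr 5 _◅◅_

_◅◅_ : ∀ {n} {G : Graph n} {P u v w} → Walk G P u v → Walk G P v w → Walk G P u w
here _     ◅◅ r = r
step p e s ◅◅ r = step p e (s ◅◅ r)

walk-reverse : ∀ {n} {G : Graph n} {P u v} → Walk G P u v → Walk G P v u
walk-reverse (here p)             = here p
walk-reverse {G = G} (step p e s) =
  walk-reverse s ◅◅ step (walk-start s) (~-sym G e) (here p)

-- A walk without repeated vertices: each step strengthens the predicate that
-- the rest of the path must satisfy.
data Path {n : ℕ} (G : Graph n) (P : Fin n → Set) : Fin n → Fin n → Set where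
  stop : ∀ {u} → P u → Path G P u u
  move : ∀ {u w v} → P u → _~_ G u w → Path G (λ z → P z × z ≢ u) w v → Path G P u v

path-map : ∀ {n} {G : Graph n} {P Q : Fin n → Set} {u v} →
           (∀ {z} → P z → Q z) → Path G P u v → Path G Q u v
path-map f (stop p)     = stop (f p)
path-map f (move p e s) = move (f p) e (path-map (λ (q , z≢u) → f q , z≢u) s)

path⇒walk : ∀ {n} {G : Graph n} {P u v} → Path G P u v → Walk G P u v
path⇒walk (stop p)     = here p
path⇒walk (move p e s) = step p e (walk-map proj₁ (path⇒walk s))

-- The loop-erasing step: if the path meets `x`, its part from `x` on replaces the whole; otherwise
-- `x` may be put in front.
avoid-or-restart : ∀ {n} {G : Graph n} {P u v} x → Path G P u v →
                   Path G (λ z → P z × z ≢ x) u v ⊎ Path G P x v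
avoid-or-restart {u = u} x s with u ≟ x
... | yes refl = inj₂ s
avoid-or-restart x (stop p)     | no u≢x = inj₁ (stop (p , u≢x))
avoid-or-restart x (move p e s) | no u≢x with avoid-or-restart x s
... | inj₁ r = inj₁ (move (p , u≢x) e (path-map (λ ((q , z≢u) , z≢x) → (q , z≢x) , z≢u) r))
... | inj₂ r = inj₂ (path-map proj₁ r)

walk⇒path : ∀ {n} {G : Graph n} {P u v} → Walk G P u v → Path G P u v
walk⇒path (here p)             = stop p
walk⇒path (step {u = u} p e s) with avoid-or-restart u (walk⇒path s)
... | inj₁ r = move p e r
... | inj₂ r = r

later : ∀ {n} {G : Graph n} {P u v} → Path G P u v → List (Fin n)
later (stop _)             = []
later (move {w = w} _ _ s) = w ∷ later s

path-all : ∀ {n} {G : Graph n} {P u v} (s : Path G P u v) → All P (u ∷ later s)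
path-all (stop p)     = p ∷ []
path-all (move p _ s) = p ∷ All.map proj₁ (path-all s)

path-unique : ∀ {n} {G : Graph n} {P u v} (s : Path G P u v) → Unique (u ∷ later s)
path-unique (stop _)     = [] ∷ []
path-unique (move _ _ s) = All.map (λ (_ , z≢u) u≡z → z≢u (sym u≡z)) (path-all s) ∷ path-unique s

path-linked : ∀ {n} {G : Graph n} {P u v a} (s : Path G P u v) → _~_ G v a →
              Linked (_~_ G) (u ∷ (later s ∷ʳ a))
path-linked (stop _)     e  = e ∷ [-]
path-linked (move _ e s) e′ = e ∷ path-linked s e′

-- If `p` and `q` differed, the loop-erased walk between them would close up through `a` to a cycle.
acyclic⇒unique-exit : ∀ {n} {G : Graph n} → ¬ HasCycle G → ∀ {a p q} →
                      _~_ G a p → _~_ G a q → Walk G (_≢ a) p q → p ≡ q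
acyclic⇒unique-exit {G = G} acyclic {a} {p} {q} a~p a~q w with walk⇒path w
... | stop _ = refl
... | s@(move _ _ r) = contradiction (a , p ∷ later s , s≤s (s≤s z≤n) , unique , linked) acyclic
  where
  unique : Unique (a ∷ p ∷ later s)
  unique = All.map (λ z≢a a≡z → z≢a (sym a≡z)) (path-all s) ∷ path-unique s
  linked : Linked (_~_ G) (a ∷ ((p ∷ later s) ∷ʳ a))
  linked = a~p ∷ path-linked s (~-sym G a~q)

-- Helly property of tree decompositions

module _ {n m} {G : Graph n} {T : Graph m} (tree : IsTree T) (D : Decomposition G T) where

  -- The bags of v, those of g i and a walk joining them avoid x, so that the first
  -- step from x towards the bags of v is also the first step inside the bags of g i.
  approach : ∀ {k} (g : Fin k → Fin n) v →
             (∀ i → ∃ λ z → g i ∈ bag D z × v ∈ bag D z) →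
             ∀ {P x y} → Path T P x y → (∀ i → g i ∈ bag D x) → v ∈ bag D y →
             ∃ λ z → v ∈ bag D z × (∀ i → g i ∈ bag D z)
  approach g v meet {x = x} s gx vy with v ∈? bag D x
  ... | yes vx = x , vx , gx
  approach g v meet (stop _) gx vy | no v∉x = contradiction vy v∉x
  approach g v meet {x = x} {y} (move {w = x′} _ x~x′ s) gx vy | no v∉x =
    approach g v meet s gx′ vy
    where
    off : ∀ {z} → v ∈ bag D z → z ≢ x
    off vz refl = v∉x vz
    gx′ : ∀ i → g i ∈ bag D x′
    gx′ i with meet i
    ... | z , giz , vz with walk⇒path (connected D (g i) x z (gx i) giz)
    ... | stop _ = contradiction vz v∉x
    ... | move {w = w} _ x~w r = subst (λ b → g i ∈ bag D b) w≡x′ (proj₁ (walk-start (path⇒walk r)))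
      where
      w≡x′ : w ≡ x′
      w≡x′ = acyclic⇒unique-exit (proj₂ tree) x~w x~x′
        (walk-map proj₂ (path⇒walk r)
         ◅◅ walk-map off (connected D v z y vz vy)
         ◅◅ walk-reverse (walk-map proj₂ (path⇒walk s)))

  -- Induction on the number of vertices: from a bag containing all but the first, `approach` moves
  -- through the tree towards a bag of the first.
  helly : ∀ {k} (g : Fin (suc k) → Fin n) →
          (∀ i j → ∃ λ z → g i ∈ bag D z × g j ∈ bag D z) →
          ∃ λ x → ∀ i → g i ∈ bag D x
  helly {zero} g meet with cover D (g zero)
  ... | x , gx = x , λ { zero → gx }
  helly {suc k} g meet with helly (g ∘ suc) (λ i j → meet (suc i) (suc j)) | cover D (g zero)
  ... | x , gx | y , gy
    with approach (g ∘ suc) (g zero) (λ i → meet (suc i) zero)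
           (walk⇒path (proj₁ tree x y)) gx gy
  ... | z , vz , gz = z , λ { zero → vz ; (suc i) → gz i }

  clique-in-bag : ∀ {k} (g : Fin (suc k) → Fin n) →
                  (∀ i j → g i ≢ g j → _~_ G (g i) (g j)) →
                  ∃ λ x → ∀ i → g i ∈ bag D x
  clique-in-bag g clique = helly g meet
    where
    meet : ∀ i j → ∃ λ z → g i ∈ bag D z × g j ∈ bag D z
    meet i j with g i ≟ g j
    ... | yes e = let z , p = cover D (g i) in z , p , subst (_∈ bag D z) e p
    ... | no ne = edgeCover D (g i) (g j) (clique i j ne)

-- Trees given by a parent function

-- The drop in `rank` makes climbing terminate and rules out cycles; `ascend` leaves `par` free at
-- `root`, where it may return `root` itself.
record Rooted {n : ℕ} (G : Graph n) : Set where
  field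
    par  : Fin n → Fin n
    rank : Fin n → ℕ
    root : Fin n
  Up : Fin n → Fin n → Set
  Up u v = par u ≡ v × rank v < rank u
  field
    edge   : ∀ {u v} → _~_ G u v → Up u v ⊎ Up v u
    ascend : ∀ v → v ≡ root ⊎ (_~_ G v (par v) × rank (par v) < rank v)

module _ {n : ℕ} {G : Graph n} (R : Rooted G) where
  open Rooted R

  walk-to-root : ∀ v → Acc _<_ (rank v) → Walk G Everything v root
  walk-to-root v (acc rs) with ascend v
  ... | inj₁ refl     = here tt
  ... | inj₂ (e , lt) = step tt e (walk-to-root (par v) (rs lt))

  -- A cycle written with its start repeated at the end is not `Unique`; this local condition still
  -- holds there and suffices for the descent.
  NonBacktracking : List (Fin n) → Set
  NonBacktracking (x ∷ l@(_ ∷ z ∷ _)) = x ≢ z × NonBacktracking l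
  NonBacktracking _                   = ⊤

  nonBacktracking : ∀ {a u} xs → Unique (u ∷ xs) → All (a ≢_) (u ∷ xs) →
                    NonBacktracking (u ∷ (xs ∷ʳ a))
  nonBacktracking []           _                       _          = _
  nonBacktracking (v ∷ [])     _                       (a≢u ∷ _)  = (λ u≡a → a≢u (sym u≡a)) , _
  nonBacktracking (v ∷ w ∷ xs) ((_ ∷ u≢w ∷ _) ∷ uniq) (_ ∷ a≢xs) =
    u≢w , nonBacktracking (w ∷ xs) uniq a≢xs

  -- A vertex has one parent, so a non-backtracking walk that goes down keeps going down.
  down-then-down : ∀ {u v a} xs → Linked (_~_ G) (u ∷ v ∷ (xs ∷ʳ a)) →
                   NonBacktracking (u ∷ v ∷ (xs ∷ʳ a)) → Up v u →
                   rank u < rank a × ∃ λ y → y ∈ₗ v ∷ xs × Up a y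
  down-then-down [] (_ ∷ e ∷ _) (u≢a , _) (pv , lt) with edge e
  ... | inj₁ (pv′ , _)  = contradiction (trans (sym pv) pv′) u≢a
  ... | inj₂ (pa , lt′) = ℕ.<-trans lt lt′ , _ , here refl , pa , lt′
  down-then-down (w ∷ xs) (_ ∷ l@(e ∷ _)) (u≢w , nb) (pv , lt) with edge e
  ... | inj₁ (pv′ , _) = contradiction (trans (sym pv) pv′) u≢w
  ... | inj₂ up with down-then-down xs l nb up
  ...   | lt′ , y , y∈ , up′ = ℕ.<-trans lt lt′ , y , there y∈ , up′

  -- Once the walk turns down it stays down, so its last step enters `a` from the parent of `a`; if
  -- it never turns, the rank only drops.
  descends-or-ends-down : ∀ {u v a} xs → Linked (_~_ G) (u ∷ v ∷ (xs ∷ʳ a)) →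
                          NonBacktracking (u ∷ v ∷ (xs ∷ʳ a)) →
                          rank a < rank u ⊎ ∃ λ y → y ∈ₗ v ∷ xs × Up a y
  descends-or-ends-down xs l@(e ∷ _) nb with edge e
  ... | inj₂ up = inj₂ (proj₂ (down-then-down xs l nb up))
  descends-or-ends-down [] (_ ∷ e ∷ _) nb | inj₁ (_ , lt) with edge e
  ... | inj₁ (_ , lt′) = inj₁ (ℕ.<-trans lt′ lt)
  ... | inj₂ up        = inj₂ (_ , here refl , up)
  descends-or-ends-down (w ∷ xs) (_ ∷ l) (_ , nb) | inj₁ (_ , lt)
    with descends-or-ends-down xs l nb
  ... | inj₁ lt′           = inj₁ (ℕ.<-trans lt′ lt)
  ... | inj₂ (y , y∈ , up) = inj₂ (y , there y∈ , up)

  rooted⇒acyclic : ¬ HasCycle G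
  rooted⇒acyclic (a , _ ∷ [] , s≤s () , _)
  rooted⇒acyclic (a , p ∷ q ∷ xs , _ , a≢@(_ ∷ a≢q ∷ _) ∷ uniq@(p≢ ∷ _) , l@(e ∷ l′)) =
    cycle (edge e)
    where
    nb : NonBacktracking (p ∷ q ∷ (xs ∷ʳ a))
    nb = nonBacktracking (q ∷ xs) uniq a≢
    cycle : ¬ (Up a p ⊎ Up p a)
    -- Starting downwards, the cycle would come back to `a` at a larger rank.
    cycle (inj₂ up) = ℕ.<-irrefl refl (proj₁ (down-then-down (q ∷ xs) l (a≢q , nb) up))
    -- Starting upwards, it cannot climb all the way back to `a`; if it ends downwards, the parent
    -- of `a` is both `p` and a later vertex, yet `p` occurs only once.
    cycle (inj₁ (pa , lt)) with descends-or-ends-down xs l′ nb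
    ... | inj₁ lt′                = ℕ.<-asym lt lt′
    ... | inj₂ (y , y∈ , pa′ , _) = All.lookup p≢ y∈ (trans (sym pa) pa′)

  rooted⇒tree : IsTree G
  rooted⇒tree = (λ u v → toRoot u ◅◅ walk-reverse (toRoot v)) , rooted⇒acyclic
    where
    toRoot : ∀ v → Walk G Everything v root
    toRoot v = walk-to-root v (<-wellFounded (rank v))

pathGraph-rooted : ∀ m → Rooted (PathGraph (suc m))
pathGraph-rooted m = record
  { par = pred ; rank = toℕ ; root = zero
  ; edge = λ { (inj₁ e) → inj₂ (up e) ; (inj₂ e) → inj₁ (up e) }
  ; ascend = λ { zero    → inj₁ refl
               ; (suc i) → inj₂ (inj₂ (cong suc (sym (toℕ-inject₁ i)))
                                , s≤s (ℕ.≤-reflexive (toℕ-inject₁ i))) } }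
  where
  up : ∀ {i j : Fin (suc m)} → toℕ j ≡ suc (toℕ i) → pred j ≡ i × toℕ i < toℕ j
  up {j = suc j} e = toℕ-injective (trans (toℕ-inject₁ j) (ℕ.suc-injective e))
                   , ℕ.≤-reflexive (sym e)

-- Cardinalities

injection⇒≤∣p∣ : ∀ {k n} (g : Fin k → Fin n) (p : Subset n) → Injective _≡_ _≡_ g →
                 (∀ i → g i ∈ p) → k ≤ ∣ p ∣
injection⇒≤∣p∣ {zero}  g p inj g∈p = z≤n
injection⇒≤∣p∣ {suc k} g p inj g∈p = ℕ.≤-trans
  (s≤s (injection⇒≤∣p∣ (g ∘ suc) (p - g zero) (suc-injective ∘ inj)
    (λ i → x∈p∧x≢y⇒x∈p-y (g∈p (suc i)) (λ e → contradiction (inj e) λ ()))))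
  (x∈p⇒∣p-x∣<∣p∣ (g∈p zero))

fromList : ∀ {n} → List (Fin n) → Subset n
fromList = ⋃ ∘ map ⁅_⁆

∈-fromList⁺ : ∀ {n} {v : Fin n} l → v ∈ₗ l → v ∈ fromList l
∈-fromList⁺ (x ∷ l) (here refl) = x∈p∪q⁺ (inj₁ (x∈⁅x⁆ x))
∈-fromList⁺ (x ∷ l) (there v∈l) = x∈p∪q⁺ (inj₂ (∈-fromList⁺ l v∈l))

∈-fromList⁻ : ∀ {n} {v : Fin n} l → v ∈ fromList l → v ∈ₗ l
∈-fromList⁻ []      v∈ = contradiction v∈ ∉⊥
∈-fromList⁻ (x ∷ l) v∈ with x∈p∪q⁻ ⁅ x ⁆ (fromList l) v∈
... | inj₁ v∈x = here (x∈⁅y⁆⇒x≡y x v∈x)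
... | inj₂ v∈l = there (∈-fromList⁻ l v∈l)

∣p∪q∣≤∣p∣+∣q∣ : ∀ {n} (p q : Subset n) → ∣ p ∪ q ∣ ≤ ∣ p ∣ + ∣ q ∣
∣p∪q∣≤∣p∣+∣q∣ []          []          = z≤n
∣p∪q∣≤∣p∣+∣q∣ (outside ∷ p) (outside ∷ q) = ∣p∪q∣≤∣p∣+∣q∣ p q
∣p∪q∣≤∣p∣+∣q∣ (outside ∷ p) (inside  ∷ q) =
  ℕ.≤-trans (s≤s (∣p∪q∣≤∣p∣+∣q∣ p q)) (ℕ.≤-reflexive (sym (ℕ.+-suc _ _)))
∣p∪q∣≤∣p∣+∣q∣ (inside  ∷ p) (outside ∷ q) = s≤s (∣p∪q∣≤∣p∣+∣q∣ p q)
∣p∪q∣≤∣p∣+∣q∣ (inside  ∷ p) (inside  ∷ q) =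
  s≤s (ℕ.≤-trans (∣p∪q∣≤∣p∣+∣q∣ p q) (ℕ.+-monoʳ-≤ ∣ p ∣ (ℕ.n≤1+n _)))

∣fromList∣≤length : ∀ {n} (l : List (Fin n)) → ∣ fromList l ∣ ≤ length l
∣fromList∣≤length {n} []  = ℕ.≤-reflexive (∣⊥∣≡0 n)
∣fromList∣≤length (x ∷ l) = ℕ.≤-trans (∣p∪q∣≤∣p∣+∣q∣ ⁅ x ⁆ (fromList l))
  (ℕ.+-mono-≤ (ℕ.≤-reflexive (∣⁅x⁆∣≡1 x)) (∣fromList∣≤length l))

-- Ternary trees

-- A node is its address, the sequence of child choices made from the root; `h` bounds its length.
data Node : ℕ → Set where
  root : ∀ {h} → Node h
  sub  : ∀ {h} → Fin 3 → Node h → Node (suc h)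

infix 4 _◁_

data _◁_ : ∀ {h} → Node h → Node h → Set where
  top  : ∀ {h j} → _◁_ {suc h} root (sub j root)
  deep : ∀ {h j} {x y : Node h} → x ◁ y → sub j x ◁ sub j y

sub-injective : ∀ {h j} {x y : Node h} → sub j x ≡ sub j y → x ≡ y
sub-injective refl = refl

◁⇒≢ : ∀ {h} {x y : Node h} → x ◁ y → x ≢ y
◁⇒≢ top      ()
◁⇒≢ (deep p) e = ◁⇒≢ p (sub-injective e)

parent : ∀ {h} → Node h → Node h
parent root              = root
parent (sub j root)      = root
parent (sub j (sub k x)) = sub j (parent (sub k x))

◁⇒parent : ∀ {h} {x y : Node h} → x ◁ y → parent y ≡ x
◁⇒parent top                      = refl
-- Splitting on `p` shows that the node below `sub j` is not itself a root, so `parent` reduces.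
◁⇒parent (deep {j = j} p@top)      = cong (sub j) (◁⇒parent p)
◁⇒parent (deep {j = j} p@(deep _)) = cong (sub j) (◁⇒parent p)

depth : ∀ {h} → Node h → ℕ
depth root      = 0
depth (sub _ x) = suc (depth x)

depth-parent : ∀ {h} j (x : Node h) → depth (parent (sub j x)) ≡ depth x
depth-parent j root      = refl
depth-parent j (sub k x) = cong suc (depth-parent k x)

#nonroot : ℕ → ℕ
#nonroot zero    = 0
#nonroot (suc h) = 3 * suc (#nonroot h)

encode : ∀ {h} → Node h → Fin (suc (#nonroot h))
encode root      = zero
encode (sub j x) = suc (combine j (encode x))

decode : ∀ {h} → Fin (suc (#nonroot h)) → Node h
decode         zero    = root
decode {suc h} (suc i) =
  let j , r = remQuot {3} (suc (#nonroot h)) i in sub j (decode r)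

decode-encode : ∀ {h} (x : Node h) → decode (encode x) ≡ x
decode-encode root      = refl
decode-encode (sub j x) = trans
  (cong (λ (k , r) → sub k (decode r)) (remQuot-combine j (encode x)))
  (cong (sub j) (decode-encode x))

encode-decode : ∀ {h} (i : Fin (suc (#nonroot h))) → encode {h} (decode i) ≡ i
encode-decode         zero    = refl
encode-decode {suc h} (suc i) = cong suc (trans
  (cong (combine j) (encode-decode {h} r))
  (combine-remQuot {3} (suc (#nonroot h)) i))
  where
  j = proj₁ (remQuot {3} (suc (#nonroot h)) i)
  r = proj₂ (remQuot {3} (suc (#nonroot h)) i)

-- One more level turns `N` nodes into `1 + 3N`, at most `4N`; base 4 is a power of two, ready for
-- comparison with a binary tree.
#nodes≤4^h : ∀ h → suc (#nonroot h) ≤ 4 ^ h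
#nodes≤4^h zero    = s≤s z≤n
#nodes≤4^h (suc h) = ℕ.≤-trans (s≤s (ℕ.m≤n+m _ _)) (ℕ.*-monoʳ-≤ 4 (#nodes≤4^h h))

-- Path decompositions

-- Applied to the positions of the bags found in the three subtrees of a root; ties are allowed.
middle : (x : Fin 3 → ℕ) → ∃ λ lo → ∃ λ mid → ∃ λ hi →
         mid ≢ lo × mid ≢ hi × x lo ≤ x mid × x mid ≤ x hi
middle x with ℕ.≤-total (x zero) (x (suc zero))
            | ℕ.≤-total (x (suc zero)) (x (suc (suc zero)))
            | ℕ.≤-total (x zero) (x (suc (suc zero)))
... | inj₁ p | inj₁ q | _      = zero , suc zero , suc (suc zero) , (λ ()) , (λ ()) , p , q
... | inj₁ p | inj₂ q | inj₁ r = zero , suc (suc zero) , suc zero , (λ ()) , (λ ()) , r , q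
... | inj₁ p | inj₂ q | inj₂ r = suc (suc zero) , zero , suc zero , (λ ()) , (λ ()) , r , p
... | inj₂ p | inj₁ q | inj₁ r = suc zero , zero , suc (suc zero) , (λ ()) , (λ ()) , p , r
... | inj₂ p | inj₁ q | inj₂ r = suc zero , suc (suc zero) , zero , (λ ()) , (λ ()) , q , r
... | inj₂ p | inj₂ q | _      = suc (suc zero) , suc zero , zero , (λ ()) , (λ ()) , q , p

-- A step in a path graph changes the position by one, so a walk cannot jump over `y`.
pathGraph-convex : ∀ {m} {Q : Fin m → Set} {x z} y → Walk (PathGraph m) Q x z →
                   toℕ x ≤ toℕ y → toℕ y ≤ toℕ z → Q y
pathGraph-convex {Q = Q} y (here q) x≤y y≤z = subst Q (toℕ-injective (ℕ.≤-antisym x≤y y≤z)) q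
pathGraph-convex {x = x} y (step {w = w} q e s) x≤y y≤z with x ≟ y
... | yes refl = q
... | no x≢y   = pathGraph-convex y s (w≤y e) y≤z
  where
  x<y : toℕ x < toℕ y
  x<y = ℕ.≤∧≢⇒< x≤y (x≢y ∘ toℕ-injective)
  w≤y : (toℕ w ≡ suc (toℕ x)) ⊎ (toℕ x ≡ suc (toℕ w)) → toℕ w ≤ toℕ y
  w≤y (inj₁ e) = ℕ.≤-trans (ℕ.≤-reflexive e) x<y
  w≤y (inj₂ e) = ℕ.≤-trans (ℕ.n≤1+n _) (ℕ.≤-trans (ℕ.≤-reflexive (sym e)) x≤y)

-- Consecutive vertices share a bag `b`. If `b` lies at or past `y`, the bags of the current vertex
-- span `y`; otherwise the search goes on along the walk from `b`.
walk-crosses-bag : ∀ {n m} {G : Graph n} (D : Decomposition G (PathGraph m)) {Q u w x z} y →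
                   Walk G Q u w → u ∈ bag D x → w ∈ bag D z →
                   toℕ x ≤ toℕ y → toℕ y ≤ toℕ z → ∃ λ v → Q v × v ∈ bag D y
walk-crosses-bag D y (here {u} q) ux uz x≤y y≤z =
  u , q , pathGraph-convex y (connected D u _ _ ux uz) x≤y y≤z
walk-crosses-bag D y (step {u} {w} q e s) ux vz x≤y y≤z with edgeCover D u w e
... | b , ub , wb with ℕ.≤-total (toℕ y) (toℕ b)
... | inj₁ y≤b = u , q , pathGraph-convex y (connected D u _ _ ux ub) x≤y y≤b
... | inj₂ b≤y = walk-crosses-bag D y s wb vz b≤y y≤z

walk-to-top : ∀ {k n} {G : Graph n} (f : Node k → Fin n) →
              (∀ {x y} → x ◁ y → _~_ G (f x) (f y)) →
              ∀ x → Walk G (λ v → ∃ λ y → v ≡ f y) (f x) (f root)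
walk-to-top f edges root = here (root , refl)
walk-to-top {G = G} f edges (sub j x) =
  walk-map (λ (y , e) → sub j y , e) (walk-to-top (f ∘ sub j) (edges ∘ deep) x)
  ◅◅ step (_ , refl) (~-sym G (edges top)) (here (_ , refl))

-- The walk joining the outer subtrees through the root has to cross the bag of the middle one.
extend-through-middle :
  ∀ {n m k} {G : Graph n} (D : Decomposition G (PathGraph m)) (f : Node (suc k) → Fin n) →
  (∀ {x y} → x ◁ y → _~_ G (f x) (f y)) →
  ∀ {lo mid hi} → mid ≢ lo → mid ≢ hi →
  ∀ {p q r} → toℕ p ≤ toℕ q → toℕ q ≤ toℕ r →
  ∀ x y → f (sub lo x) ∈ bag D p → f (sub hi y) ∈ bag D r →
  ∀ {l} (g : Fin l → Node k) → Injective _≡_ _≡_ g → (∀ c → f (sub mid (g c)) ∈ bag D q) →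
  ∃ λ (g′ : Fin (suc l) → Node (suc k)) → Injective _≡_ _≡_ g′ × (∀ c → f (g′ c) ∈ bag D q)
extend-through-middle {n} {k = k} {G} D f edges {lo} {mid} {hi} mid≢lo mid≢hi {q = q}
  p≤q q≤r x y x∈ y∈ {l} g g-inj g∈ =
  insert (walk-crosses-bag D q (climb lo mid≢lo x ◅◅ walk-reverse (climb hi mid≢hi y)) x∈ y∈ p≤q q≤r)
  where
  Outside : Fin n → Set
  Outside v = ∃ λ z → (∀ w → z ≢ sub mid w) × v ≡ f z
  climb : ∀ j → mid ≢ j → ∀ z → Walk G Outside (f (sub j z)) (f root)
  climb j mid≢j z =
    walk-map (λ (w , e) → sub j w , (λ { _ refl → mid≢j refl }) , e)
      (walk-to-top (f ∘ sub j) (edges ∘ deep) z)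
    ◅◅ step (_ , (λ { _ refl → mid≢j refl }) , refl) (~-sym G (edges top))
         (here (root , (λ _ ()) , refl))
  insert : (∃ λ v → Outside v × v ∈ bag D q) →
           ∃ λ (g′ : Fin (suc l) → Node (suc k)) →
             Injective _≡_ _≡_ g′ × (∀ c → f (g′ c) ∈ bag D q)
  insert (_ , (z , z≢mid , refl) , z∈) = g′ , g′-inj , λ { zero → z∈ ; (suc c) → g∈ c }
    where
    g′ : Fin (suc l) → Node (suc k)
    g′ zero    = z
    g′ (suc c) = sub mid (g c)
    g′-inj : Injective _≡_ _≡_ g′
    g′-inj {zero}  {zero}  _ = refl
    g′-inj {zero}  {suc d} e = contradiction e (z≢mid (g d))
    g′-inj {suc c} {zero}  e = contradiction (sym e) (z≢mid (g c))
    g′-inj {suc c} {suc d} e = cong suc (g-inj (sub-injective e))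

-- One bag must serve every index. It starts as a bag containing a whole block, which is a clique,
-- and each level keeps the bag of the middle subtree, a choice that depends on positions only and
-- not on `i`.
rich-bag : ∀ {n m t} {G : Graph n} (D : Decomposition G (PathGraph (suc m)))
           k (f : Node k → Fin (suc t) → Fin n) →
           (∀ x i j → f x i ≢ f x j → _~_ G (f x i) (f x j)) →
           (∀ i {x y} → x ◁ y → _~_ G (f x i) (f y i)) →
           ∃ λ b → ∀ i → ∃ λ (g : Fin (suc k) → Node k) →
             Injective _≡_ _≡_ g × (∀ c → f (g c) i ∈ bag D b)
rich-bag {m = m} D zero f cliques edges
  with clique-in-bag (rooted⇒tree (pathGraph-rooted m)) D (f root) (cliques root)
... | b , ∈b = b , λ i → (λ _ → root) , (λ { {zero} {zero} _ → refl }) , (λ _ → ∈b i)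
rich-bag D (suc k) f cliques edges
  with (λ j → rich-bag D k (f ∘ sub j) (cliques ∘ sub j) (λ i → edges i ∘ deep))
... | rich with middle (toℕ ∘ proj₁ ∘ rich)
... | lo , mid , hi , mid≢lo , mid≢hi , lo≤mid , mid≤hi = proj₁ (rich mid) , λ i →
  let gˡ , _ , gˡ∈        = proj₂ (rich lo) i
      gᵐ , gᵐ-inj , gᵐ∈ = proj₂ (rich mid) i
      gʰ , _ , gʰ∈        = proj₂ (rich hi) i
  in extend-through-middle D (λ x → f x i) (edges i) mid≢lo mid≢hi lo≤mid mid≤hi
       -- One vertex from each outer subtree is enough to route the crossing walk of index `i`.
       (gˡ zero) (gʰ zero) (gˡ∈ zero) (gʰ∈ zero) gᵐ gᵐ-inj gᵐ∈

-- The extremal graph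

module Construction (h s : ℕ) where

  t size : ℕ
  t    = suc s
  size = suc (#nonroot h) * t

  vertex : Node h → Fin t → Fin size
  vertex x i = combine (encode x) i

  node : Fin size → Node h
  node v = decode (proj₁ (remQuot {suc (#nonroot h)} t v))

  index : Fin size → Fin t
  index v = proj₂ (remQuot {suc (#nonroot h)} t v)

  vertex-surjective : ∀ v → vertex (node v) (index v) ≡ v
  vertex-surjective v = trans
    (cong (λ a → combine a (index v)) (encode-decode {h} (proj₁ (remQuot {suc (#nonroot h)} t v))))
    (combine-remQuot {suc (#nonroot h)} t v)

  node-vertex : ∀ x i → node (vertex x i) ≡ x
  node-vertex x i = trans (cong (decode ∘ proj₁) (remQuot-combine (encode x) i)) (decode-encode x)

  index-vertex : ∀ x i → index (vertex x i) ≡ i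
  index-vertex x i = cong proj₂ (remQuot-combine (encode x) i)

  up : Node h → Fin t → Fin size
  up x         (suc i) = vertex x (inject₁ i)
  -- The topmost vertex gets itself as a default.
  up root      zero    = vertex root zero
  up (sub j x) zero    = vertex (parent (sub j x)) (fromℕ s)

  par : Fin size → Fin size
  par v = up (node v) (index v)

  -- This is the depth of the vertex in `T`, each block above it counting `t`.
  rank : Fin size → ℕ
  rank v = depth (node v) * t + toℕ (index v)

  par-vertex : ∀ x i → par (vertex x i) ≡ up x i
  par-vertex x i = cong₂ up (node-vertex x i) (index-vertex x i)

  rank-vertex : ∀ x i → rank (vertex x i) ≡ depth x * t + toℕ i
  rank-vertex x i = cong₂ (λ y j → depth y * t + toℕ j) (node-vertex x i) (index-vertex x i)

  up-lowers-rank : ∀ x i → vertex x i ≡ vertex root zero ⊎ rank (up x i) < depth x * t + toℕ i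
  up-lowers-rank x (suc i) = inj₂ (begin-strict
    rank (vertex x (inject₁ i))     ≡⟨ rank-vertex x (inject₁ i) ⟩
    depth x * t + toℕ (inject₁ i)   <⟨ ℕ.+-monoʳ-< (depth x * t) (s≤s (ℕ.≤-reflexive (toℕ-inject₁ i))) ⟩
    depth x * t + suc (toℕ i)       ∎)
    where open ℕ.≤-Reasoning
  up-lowers-rank root      zero = inj₁ refl
  up-lowers-rank (sub j x) zero = inj₂ (begin-strict
    rank (vertex (parent (sub j x)) (fromℕ s))      ≡⟨ rank-vertex (parent (sub j x)) (fromℕ s) ⟩
    depth (parent (sub j x)) * t + toℕ (fromℕ s)    ≡⟨ cong₂ (λ d i → d * t + i) (depth-parent j x) (toℕ-fromℕ s) ⟩
    depth x * t + s                                 <⟨ ℕ.+-monoʳ-< (depth x * t) (ℕ.n<1+n s) ⟩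
    depth x * t + t                                 ≡⟨ ℕ.+-comm (depth x * t) t ⟩
    suc (depth x) * t                               ≡⟨ ℕ.+-identityʳ _ ⟨
    suc (depth x) * t + 0                           ∎)
    where open ℕ.≤-Reasoning

  par-lowers-rank : ∀ v → v ≡ vertex root zero ⊎ rank (par v) < rank v
  par-lowers-rank v with up-lowers-rank (node v) (index v)
  ... | inj₁ e  = inj₁ (trans (sym (vertex-surjective v)) e)
  ... | inj₂ lt = inj₂ lt

  T : Graph size
  T = record
    { _~_    = λ u v → Up u v ⊎ Up v u
    ; ~-sym  = swap
    ; irrefl = λ { u (inj₁ (_ , lt)) → ℕ.<-irrefl refl lt
                 ; u (inj₂ (_ , lt)) → ℕ.<-irrefl refl lt } }
    where
    Up : Fin size → Fin size → Set
    Up u v = par u ≡ v × rank v < rank u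

  T-rooted : Rooted T
  T-rooted = record
    { par = par ; rank = rank ; root = vertex root zero ; edge = id ; ascend = ascend }
    where
    ascend : ∀ v → v ≡ vertex root zero ⊎ (_~_ T v (par v) × rank (par v) < rank v)
    ascend v with par-lowers-rank v
    ... | inj₁ e  = inj₁ e
    ... | inj₂ lt = inj₂ (inj₁ (refl , lt) , lt)

  -- Bags of nearest ancestors and the graph they define

  ancestors : Fin size → ℕ → List (Fin size)
  ancestors = iterate par

  ancestors-mono : ∀ {k l v} x → k ≤ l → v ∈ₗ ancestors x k → v ∈ₗ ancestors x l
  ancestors-mono x (s≤s k≤l) (here e)   = here e
  ancestors-mono x (s≤s k≤l) (there v∈) = there (ancestors-mono (par x) k≤l v∈)

  -- The list begins with `v` and repeats the topmost vertex once that is reached; as a set it has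
  -- at most `t + 1` elements.
  ancestorBag : Fin size → Subset size
  ancestorBag v = fromList (ancestors v (suc t))

  ancestor∈bag : ∀ v {u} → u ∈ₗ ancestors v (suc t) → u ∈ ancestorBag v
  ancestor∈bag v = ∈-fromList⁺ (ancestors v (suc t))

  self∈bag : ∀ v → v ∈ ancestorBag v
  self∈bag v = ancestor∈bag v (here refl)

  G : Graph size
  G = record
    { _~_    = λ u v → u ≢ v × ∃ λ x → u ∈ ancestorBag x × v ∈ ancestorBag x
    ; ~-sym  = λ (u≢v , x , ux , vx) → (λ e → u≢v (sym e)) , x , vx , ux
    ; irrefl = λ _ (u≢u , _) → u≢u refl }

  -- Climbing from `x` only brings `v` nearer, so every bag on the way still reaches `v`.
  walk-to-ancestor : ∀ k x {v} → k ≤ suc t → v ∈ₗ ancestors x k →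
                     Walk T (λ z → v ∈ ancestorBag z) x v
  walk-to-ancestor (suc k) x     k< (here refl) = here (self∈bag x)
  walk-to-ancestor (suc k) x {v} k< (there v∈)
    with walk-to-ancestor k (par x) (ℕ.<⇒≤ k<) v∈ | par-lowers-rank x
  ... | w | inj₂ lt   =
    step (ancestor∈bag x (ancestors-mono x k< (there v∈))) (inj₁ (refl , lt)) w
  -- At the topmost vertex `par` does not move, so the recursive walk already starts in the right
  -- place.
  ... | w | inj₁ refl =
    subst (λ z → Walk T (λ z → v ∈ ancestorBag z) z v) (par-vertex root zero) w

  treeDecomposition : TreeDecomposition G
  treeDecomposition = record
    { T = T ; isTree = rooted⇒tree T-rooted ; dec = record
      { bag       = ancestorBag
      ; cover     = λ v → v , self∈bag v
      ; edgeCover = λ _ _ → proj₂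
      -- From every vertex whose bag holds `v` one can climb to `v`, where the two walks meet.
      ; connected = λ v x y vx vy →
          walk-to-ancestor _ x ℕ.≤-refl (∈-fromList⁻ _ vx)
          ◅◅ walk-reverse (walk-to-ancestor _ y ℕ.≤-refl (∈-fromList⁻ _ vy)) } }

  width≤ : WidthAtMost (TreeDecomposition.dec treeDecomposition) t
  width≤ x = ℕ.∸-monoˡ-≤ 1 (ℕ.≤-trans (∣fromList∣≤length (ancestors x (suc t)))
    (ℕ.≤-reflexive (length-iterate par x (suc t))))

  -- Ancestors within a block and in the parent block

  same-block-ancestor : ∀ d x i j {k} → toℕ j ≡ d + toℕ i → d < k →
                        vertex x i ∈ₗ ancestors (vertex x j) k
  same-block-ancestor zero    x i j       {suc k} e _        =
    here (cong (vertex x) (toℕ-injective (sym e)))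
  same-block-ancestor (suc d) x i (suc j) {suc k} e (s≤s lt) =
    there (subst (λ v → vertex x i ∈ₗ ancestors v k) (sym (par-vertex x (suc j)))
      (same-block-ancestor d x i (inject₁ j) (trans (toℕ-inject₁ j) (ℕ.suc-injective e)) lt))

  block-ancestor : ∀ x i {k} → s ∸ toℕ i < k → vertex x i ∈ₗ ancestors (vertex x (fromℕ s)) k
  block-ancestor x i = same-block-ancestor (s ∸ toℕ i) x i (fromℕ s)
    (trans (toℕ-fromℕ s) (sym (ℕ.m∸n+n≡m (toℕ≤pred[n] i))))

  up-◁ : ∀ {x y} → x ◁ y → up y zero ≡ vertex x (fromℕ s)
  up-◁ {y = sub j z} x◁y = cong (λ p → vertex p (fromℕ s)) (◁⇒parent x◁y)

  -- It takes `toℕ j` steps to the top of the block of `y`, one to the last vertex of the block of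
  -- `x`, and `s ∸ toℕ i` more to index `i`.
  parent-block-ancestor : ∀ {x y} → x ◁ y → ∀ i j {k} → suc (toℕ j + (s ∸ toℕ i)) < k →
                          vertex x i ∈ₗ ancestors (vertex y j) k
  parent-block-ancestor {x} {y} x◁y i zero    {suc k} (s≤s lt) =
    there (subst (λ v → vertex x i ∈ₗ ancestors v k)
      (sym (trans (par-vertex y zero) (up-◁ x◁y))) (block-ancestor x i lt))
  parent-block-ancestor {x} {y} x◁y i (suc j) {suc k} (s≤s lt) =
    there (subst (λ v → vertex x i ∈ₗ ancestors v k) (sym (par-vertex y (suc j)))
      (parent-block-ancestor x◁y i (inject₁ j)
        (subst (λ l → suc (l + (s ∸ toℕ i)) < k) (sym (toℕ-inject₁ j)) lt)))

  -- The bag of the last vertex of a block covers the block, whose vertices are at most `s` steps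
  -- above it.
  block-clique : ∀ x i j → vertex x i ≢ vertex x j → _~_ G (vertex x i) (vertex x j)
  block-clique x i j ne = ne , vertex x (fromℕ s) , in-bag i , in-bag j
    where
    in-bag : ∀ i → vertex x i ∈ ancestorBag (vertex x (fromℕ s))
    in-bag i = ancestor∈bag (vertex x (fromℕ s)) (block-ancestor x i (s≤s (ℕ.m≤n⇒m≤1+n (ℕ.m∸n≤m s (toℕ i)))))

  vertex-injective : ∀ x y i j → vertex x i ≡ vertex y j → x ≡ y × i ≡ j
  vertex-injective x y i j e =
    trans (sym (node-vertex x i)) (trans (cong node e) (node-vertex y j)) ,
    trans (sym (index-vertex x i)) (trans (cong index e) (index-vertex y j))

  -- With equal indices the distance is `i + 1 + (s - i) = t`, exactly as far as a bag reaches.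
  ◁⇒adjacent : ∀ i {x y} → x ◁ y → _~_ G (vertex x i) (vertex y i)
  ◁⇒adjacent i {x} {y} x◁y =
    (λ e → ◁⇒≢ x◁y (proj₁ (vertex-injective x y i i e))) , vertex y i ,
    ancestor∈bag (vertex y i) (parent-block-ancestor x◁y i i
      (s≤s (s≤s (ℕ.≤-reflexive (ℕ.m+[n∸m]≡n (toℕ≤pred[n] i)))))) ,
    self∈bag (vertex y i)

  -- The bag of the first vertex of a child block also holds the whole root block, which makes a
  -- clique of `t + 1` vertices. The child `c` exists because the height is positive.
  treewidth≥ : ∀ {c} → root ◁ c → ∀ (D : TreeDecomposition G) →
               WidthAtLeast (TreeDecomposition.dec D) t
  treewidth≥ {c} root◁c D =
    let x , g∈ = clique-in-bag isTree dec g clique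
    in x , ℕ.∸-monoˡ-≤ 1 (injection⇒≤∣p∣ g (bag dec x) g-inj g∈)
    where
    open TreeDecomposition D using (isTree; dec)
    g : Fin (suc t) → Fin size
    g zero    = vertex c zero
    g (suc i) = vertex root i
    in-bag : ∀ i → g i ∈ ancestorBag (vertex c zero)
    in-bag zero    = self∈bag (vertex c zero)
    in-bag (suc i) = ancestor∈bag (vertex c zero) (parent-block-ancestor root◁c i zero
      (s≤s (s≤s (ℕ.m∸n≤m s (toℕ i)))))
    clique : ∀ i j → g i ≢ g j → _~_ G (g i) (g j)
    clique i j ne = ne , vertex c zero , in-bag i , in-bag j
    g-inj : Injective _≡_ _≡_ g
    g-inj {zero}  {zero}  _ = refl
    g-inj {zero}  {suc j} e = contradiction (sym (proj₁ (vertex-injective c root zero j e))) (◁⇒≢ root◁c)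
    g-inj {suc i} {zero}  e = contradiction (proj₁ (vertex-injective root c i zero e)) (◁⇒≢ root◁c)
    g-inj {suc i} {suc j} e = cong suc (proj₂ (vertex-injective root root i j e))

  -- Each of the `t` indices contributes `h + 1` vertices to the same bag, and vertices of different
  -- index are distinct.
  pathwidth≥ : PathwidthAtLeast G (t * (h + 1) ∸ 1)
  pathwidth≥ D with rich-bag (PathDecomposition.dec D) h vertex block-clique ◁⇒adjacent
  ... | b , rich = b , ℕ.∸-monoˡ-≤ 1 (subst (λ k → t * k ≤ ∣ bag (PathDecomposition.dec D) b ∣)
                         (ℕ.+-comm 1 h) (injection⇒≤∣p∣ g _ g-inj g∈))
    where
    pick : Fin t × Fin (suc h) → Fin size
    pick (i , c) = vertex (proj₁ (rich i) c) i
    pick-inj : ∀ p q → pick p ≡ pick q → p ≡ q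
    pick-inj (i , c) (j , d) e with vertex-injective (proj₁ (rich i) c) (proj₁ (rich j) d) i j e
    ... | x≡y , refl = cong (i ,_) (proj₁ (proj₂ (rich i)) x≡y)
    g : Fin (t * suc h) → Fin size
    g = pick ∘ remQuot {t} (suc h)
    g-inj : Injective _≡_ _≡_ g
    g-inj {k} {l} e = trans (sym (combine-remQuot {t} (suc h) k))
      (trans (cong (uncurry combine) (pick-inj (remQuot {t} (suc h) k) (remQuot {t} (suc h) l) e)) (combine-remQuot {t} (suc h) l))
    g∈ : ∀ k → g k ∈ bag (PathDecomposition.dec D) b
    g∈ k = let i , c = remQuot {t} (suc h) k in proj₂ (proj₂ (rich i)) c

-- Comparison of vertex counts

n≤2^⌈log2⌉n : ∀ n (a : Acc _<_ n) → n ≤ 2 ^ ⌈log2⌉ n a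
n≤2^⌈log2⌉n zero          _        = z≤n
n≤2^⌈log2⌉n (suc zero)    _        = s≤s z≤n
-- From two on, `⌈log2⌉` is one plus its value at the half rounded up, and twice that half bounds
-- the number.
n≤2^⌈log2⌉n (suc (suc n)) (acc rs) = begin
  suc (suc n)                                           ≡⟨ ℕ.⌊n/2⌋+⌈n/2⌉≡n (suc (suc n)) ⟨
  ⌊ suc (suc n) /2⌋ + ⌈ suc (suc n) /2⌉                 ≤⟨ ℕ.+-monoˡ-≤ _ (ℕ.⌊n/2⌋≤⌈n/2⌉ (suc (suc n))) ⟩
  ⌈ suc (suc n) /2⌉ + ⌈ suc (suc n) /2⌉                 ≡⟨ cong (⌈ suc (suc n) /2⌉ +_) (ℕ.+-identityʳ _) ⟨
  2 * ⌈ suc (suc n) /2⌉                                 ≤⟨ ℕ.*-monoʳ-≤ 2 (n≤2^⌈log2⌉n ⌈ suc (suc n) /2⌉ _) ⟩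
  2 ^ ⌈log2⌉ (suc (suc n)) (acc rs)                     ∎
  where open ℕ.≤-Reasoning

-- With `M` the maximum, `4 ^ h` is at most `2 ^ (2 * M)` and `t` at most `2 ^ M`; together they
-- give the exponent `3 * M`, the forbidden height.
size<tree : ∀ h t → suc (#nonroot h) * t <
            2 ^ suc (3 * (suc h ⊔ ⌈log₂ t ⌉)) ∸ 1
size<tree h t = begin-strict
  suc (#nonroot h) * t  ≤⟨ ℕ.*-mono-≤ (#nodes≤4^h h) (n≤2^⌈log2⌉n t _) ⟩
  4 ^ h * 2 ^ ⌈log₂ t ⌉ ≤⟨ ℕ.*-mono-≤ (ℕ.^-monoʳ-≤ 4 (ℕ.≤-trans (ℕ.n≤1+n h) h<M)) (ℕ.^-monoʳ-≤ 2 (ℕ.m≤n⊔m (suc h) ⌈log₂ t ⌉)) ⟩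
  4 ^ M * 2 ^ M         ≡⟨ cong (_* 2 ^ M) (ℕ.^-*-assoc 2 2 M) ⟩
  2 ^ (2 * M) * 2 ^ M   ≡⟨ ℕ.^-distribˡ-+-* 2 (2 * M) M ⟨
  2 ^ (2 * M + M)       ≡⟨ cong (2 ^_) (ℕ.+-comm (2 * M) M) ⟩
  2 ^ (3 * M)           <⟨ ℕ.m+n≤o⇒m≤o∸n (suc (2 ^ (3 * M))) lt ⟩
  2 ^ suc (3 * M) ∸ 1   ∎
  where
  open ℕ.≤-Reasoning
  M = suc h ⊔ ⌈log₂ t ⌉
  h<M : h < M
  h<M = ℕ.m≤m⊔n (suc h) ⌈log₂ t ⌉
  lt : suc (2 ^ (3 * M)) + 1 ≤ 2 ^ suc (3 * M)
  lt = begin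
    suc (2 ^ (3 * M)) + 1         ≡⟨ ℕ.+-suc (2 ^ (3 * M)) 1 ⟨
    -- The 2 pays for strictness and for the `∸ 1`; it is at most `2 ^ (3 * M)` because `M` is
    -- positive.
    2 ^ (3 * M) + 2               ≤⟨ ℕ.+-monoʳ-≤ (2 ^ (3 * M)) (ℕ.^-monoʳ-≤ 2 (ℕ.≤-trans (s≤s z≤n) (ℕ.≤-trans h<M (ℕ.m≤m+n M _)))) ⟩
    2 ^ (3 * M) + 2 ^ (3 * M)     ≡⟨ cong (2 ^ (3 * M) +_) (ℕ.+-identityʳ _) ⟨
    2 ^ suc (3 * M)               ∎

theorem16 : ∀ (t h : ℕ) → 1 ≤ t → 1 ≤ h →
    Σ ℕ λ n → Σ (Graph n) λ G →
    HasTreewidth G t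
    × PathwidthAtLeast G (t * (h + 1) ∸ 1)
    × ¬ ContainsSubdivision G (CompleteBinaryTree (3 * (suc h ⊔ ⌈log₂ t ⌉)))
theorem16 (suc s) (suc h) _ _ =
  size , G , ((treeDecomposition , width≤) , treewidth≥ {sub zero root} top) , pathwidth≥ ,
  -- The branch vertices alone would inject a larger set into the vertices of `G`.
  λ S → ℕ.<⇒≱ (size<tree (suc h) (suc s))
          (injective⇒≤ (ContainsSubdivision.φ-inj S _ _))
  where open Construction (suc h) s
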